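{- Let $n\ge 1$. Among the simply paired partitions of $n$ having negative pairing rank, let $E_{\mathrm{sp}}(n)$ count those with $b(\lambda)$ even and let $O_{\mathrm{sp}}(n)$ count those with $b(\lambda)$ odd. Then $$E_{\mathrm{sp}}(n)-O_{\mathrm{sp}}(n)=d_{\mathrm{odd}}(n),$$ where $d_{\mathrm{odd}}(n)$ is the number of odd positive divisors of $n$.
   Context: A partition is simply paired if no part occurs more than three times. For a simply paired partition $\lambda$, $b(\lambda)$ is the number of distinct part sizes that participate in a pair, i.e. that occur two or three times. For a partition $\lambda$, let $r(\lambda)$ be the largest part size of multiplicity at least $2$ ($r(\lambda)=0$ if $\lambda$ has distinct parts). Let $u_1>u_2>\cdots$ be the part sizes occurring with odd multiplicity, each taken once, and let $s(\lambda)=u_1-u_2+u_3-u_4+\cdots$ ($0$ if there are none). The pairing rank is $\rho(\lambda)=r(\lambda)-s(\lambda)$. -}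

module Defs where

open import Data.Integer as ℤ using (ℤ; 0ℤ)
import Data.Integer.Properties as ℤₚ
open import Data.List using (List; []; _∷_; _++_; length; map; filter; deduplicate; concatMap; replicate; upTo; applyUpTo)
open import Data.List.Extrema.Nat using (max)
open import Data.List.Membership.Propositional using (_∈_; find; lose)
open import Data.List.Membership.Propositional.Properties using (∈-concatMap⁺; ∈-concatMap⁻; ∈-map⁺; ∈-map⁻; ∈-upTo⁺; ∈-upTo⁻)
open import Data.List.Properties using (∷-injectiveʳ; ++-cancelˡ)
open import Data.List.Relation.Unary.All as All using (All; []; _∷_)
import Data.List.Relation.Unary.All.Properties as Allₚ
open import Data.List.Relation.Unary.AllPairs using (AllPairs; []; _∷_)
import Data.List.Relation.Unary.AllPairs.Properties as AllPairsₚ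
open import Data.List.Relation.Unary.Any using (here)
open import Data.List.Relation.Unary.Unique.Propositional using (Unique)
import Data.List.Relation.Unary.Unique.Propositional.Properties as Uniqueₚ
open import Data.Nat using (ℕ; zero; suc; _+_; _*_; _∸_; _/_; _≤_; _<_; _≥_; s≤s; z<s; _≟_; _≤?_)
open import Data.Nat.Divisibility using (_∣_; _∣?_)
open import Data.Nat.ListAction using (sum)
open import Data.Nat.DivMod using (m/n*n≤m; m*n/n≡m; /-monoˡ-≤)
open import Data.Nat.Properties using (≤-refl; ≤-trans; ≤-reflexive; m≤n⇒m≤1+n; m≤n+m; m≤m+n; m+[n∸m]≡n; m+n∸m≡n; *-monoˡ-≤; <⇒≢; n≮n; m≤n⇒m<n∨m≡n; +-assoc)
open import Data.Product using (_×_; _,_; proj₁; proj₂; ∃-syntax)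
open import Data.Sum using (inj₁; inj₂)
open import Function using (_⇔_; mk⇔)
open import Relation.Binary.PropositionalEquality using (_≡_; refl; sym; trans; cong; subst)
open import Relation.Nullary using (¬_; ¬?; _×-dec_; _⊎-dec_; contradiction)
open import Relation.Unary using (Decidable)

-- The parts are listed in weakly decreasing order.

IsPartition : ℕ → List ℕ → Set
IsPartition n λs = AllPairs _≥_ λs × All (0 <_) λs × sum λs ≡ n

-- All partitions of n with parts at most m; k is the multiplicity of
-- the largest allowed part.  `∈-partitions` and `partitions-unique`
-- below show that `partitions n` lists each partition of n exactly once.

partitions≤ : ℕ → ℕ → List (List ℕ)
partitions≤ zero    zero    = [] ∷ []
partitions≤ zero    (suc _) = []
partitions≤ (suc m) n       =
  concatMap (λ k → map (replicate k (suc m) ++_) (partitions≤ m (n ∸ k * suc m)))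
            (upTo (suc (n / suc m)))

partitions : ℕ → List (List ℕ)
partitions n = partitions≤ n n

count : {A : Set} {P : A → Set} → Decidable P → List A → ℕ
count P? xs = length (filter P? xs)

Odd Even : ℕ → Set
Even n = 2 ∣ n
Odd  n = ¬ (2 ∣ n)

even? : Decidable Even
even? n = 2 ∣? n

odd? : Decidable Odd
odd? n = ¬? (2 ∣? n)

multiplicity : List ℕ → ℕ → ℕ
multiplicity λs i = count (i ≟_) λs

-- Keeps the first occurrence of each part, so the part sizes of a
-- partition come out strictly decreasing.

partSizes : List ℕ → List ℕ
partSizes = deduplicate _≟_

SimplyPaired : List ℕ → Set
SimplyPaired λs = All (λ i → multiplicity λs i ≤ 3) λs

simplyPaired? : Decidable SimplyPaired
simplyPaired? λs = All.all? (λ i → multiplicity λs i ≤? 3) λs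

b : List ℕ → ℕ
b λs = count (λ i → (multiplicity λs i ≟ 2) ⊎-dec (multiplicity λs i ≟ 3)) (partSizes λs)

r : List ℕ → ℕ
r λs = max 0 (filter (λ i → 2 ≤? multiplicity λs i) (partSizes λs))

-- u₁ - (u₂ - (u₃ - ⋯)) = u₁ - u₂ + u₃ - ⋯

alternatingSum : List ℕ → ℤ
alternatingSum []       = 0ℤ
alternatingSum (u ∷ us) = ℤ.+ u ℤ.- alternatingSum us

s : List ℕ → ℤ
s λs = alternatingSum (filter (λ i → odd? (multiplicity λs i)) (partSizes λs))

ρ : List ℕ → ℤ
ρ λs = ℤ.+ r λs ℤ.- s λs

Eₛₚ Oₛₚ : ℕ → ℕ
Eₛₚ n = count (λ λs → simplyPaired? λs ×-dec (ρ λs ℤₚ.<? 0ℤ) ×-dec even? (b λs)) (partitions n)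
Oₛₚ n = count (λ λs → simplyPaired? λs ×-dec (ρ λs ℤₚ.<? 0ℤ) ×-dec odd?  (b λs)) (partitions n)

-- For n ≥ 1 every positive divisor of n lies in 1, …, n.

d-odd : ℕ → ℕ
d-odd n = count (λ d → odd? d ×-dec (d ∣? n)) (applyUpTo suc n)

sum-replicate-++ : ∀ k M (p : List ℕ) → sum (replicate k M ++ p) ≡ k * M + sum p
sum-replicate-++ zero    M p = refl
sum-replicate-++ (suc k) M p =
  trans (cong (M +_) (sum-replicate-++ k M p)) (sym (+-assoc M (k * M) (sum p)))

partitions≤-sound : ∀ m n {p} → p ∈ partitions≤ m n → IsPartition n p × All (_≤ m) p
partitions≤-sound zero    zero    (here refl) = ([] , [] , refl) , []
partitions≤-sound (suc m) n       p∈
  with k , k∈ , p∈k ← find (∈-concatMap⁻ _ {xs = upTo (suc (n / suc m))} p∈)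
  with q , q∈ , refl ← ∈-map⁻ (replicate k (suc m) ++_) p∈k
  with (dec , pos , sum≡) , q≤m ← partitions≤-sound m (n ∸ k * suc m) q∈
  = ( AllPairsₚ.++⁺ (replicate-dec k) dec (Allₚ.replicate⁺ k (All.map m≤n⇒m≤1+n q≤m))
    , Allₚ.++⁺ (Allₚ.replicate⁺ k z<s) pos
    , trans (sum-replicate-++ k (suc m) q)
            (trans (cong (k * suc m +_) sum≡) (m+[n∸m]≡n k*M≤n)) )
  , Allₚ.++⁺ (Allₚ.replicate⁺ k ≤-refl) (All.map m≤n⇒m≤1+n q≤m)
  where
  replicate-dec : ∀ k → AllPairs _≥_ (replicate k (suc m))
  replicate-dec zero    = []
  replicate-dec (suc k) = Allₚ.replicate⁺ k ≤-refl ∷ replicate-dec k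

  k*M≤n : k * suc m ≤ n
  k*M≤n with s≤s k≤ ← ∈-upTo⁻ k∈ = ≤-trans (*-monoˡ-≤ (suc m) k≤) (m/n*n≤m n (suc m))

split-largest : ∀ m p → AllPairs _≥_ p → All (_≤ suc m) p →
                ∃[ k ] ∃[ q ] p ≡ replicate k (suc m) ++ q × AllPairs _≥_ q × All (_≤ m) q
split-largest m []      []          []        = 0 , [] , refl , [] , []
split-largest m (x ∷ p) (x≥p ∷ dec) (x≤ ∷ p≤) with m≤n⇒m<n∨m≡n x≤
... | inj₁ (s≤s x≤m) = 0 , x ∷ p , refl , x≥p ∷ dec , x≤m ∷ All.map (λ y≤x → ≤-trans y≤x x≤m) x≥p
... | inj₂ refl with k , q , refl , dec′ , q≤m ← split-largest m p dec p≤
  = suc k , q , refl , dec′ , q≤m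

partitions≤-complete : ∀ m n {p} → IsPartition n p → All (_≤ m) p → p ∈ partitions≤ m n
partitions≤-complete zero    _ {[]}    (_ , _ , refl)       _       = here refl
partitions≤-complete zero    _ {_ ∷ _} (_ , s≤s _ ∷ _ , _)  (() ∷ _)
partitions≤-complete (suc m) n {p} (dec , pos , sum≡) p≤
  with k , q , refl , dec′ , q≤m ← split-largest m p dec p≤
  = ∈-concatMap⁺ _ (lose (∈-upTo⁺ (s≤s k≤)) (∈-map⁺ (replicate k (suc m) ++_)
      (partitions≤-complete m (n ∸ k * suc m)
        (dec′ , Allₚ.++⁻ʳ (replicate k (suc m)) pos , sumq) q≤m)))
  where
  n≡ : k * suc m + sum q ≡ n
  n≡ = trans (sym (sum-replicate-++ k (suc m) q)) sum≡

  sumq : sum q ≡ n ∸ k * suc m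
  sumq = trans (sym (m+n∸m≡n (k * suc m) (sum q))) (cong (_∸ k * suc m) n≡)

  k≤ : k ≤ n / suc m
  k≤ = subst (_≤ n / suc m) (m*n/n≡m k (suc m))
         (/-monoˡ-≤ (suc m) (≤-trans (m≤m+n _ (sum q)) (≤-reflexive n≡)))

parts≤sum : ∀ p → All (_≤ sum p) p
parts≤sum []      = []
parts≤sum (x ∷ p) = m≤m+n x (sum p) ∷ All.map (λ y≤ → ≤-trans y≤ (m≤n+m (sum p) x)) (parts≤sum p)

∈-partitions : ∀ n p → p ∈ partitions n ⇔ IsPartition n p
∈-partitions n p = mk⇔ (λ p∈ → proj₁ (partitions≤-sound n n p∈)) complete
  where
  complete : IsPartition n p → p ∈ partitions n
  complete P@(_ , _ , refl) = partitions≤-complete n n P (parts≤sum p)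

replicate-++-injective : ∀ {m} j k {p q} → All (_≤ m) p → All (_≤ m) q →
                         replicate j (suc m) ++ p ≡ replicate k (suc m) ++ q → j ≡ k × p ≡ q
replicate-++-injective zero    zero    p≤ q≤ eq = refl , eq
replicate-++-injective zero    (suc k) (1+m≤m ∷ _) q≤ refl = contradiction 1+m≤m (n≮n _)
replicate-++-injective (suc j) zero    p≤ (1+m≤m ∷ _) refl = contradiction 1+m≤m (n≮n _)
replicate-++-injective (suc j) (suc k) p≤ q≤ eq
  with refl , p≡q ← replicate-++-injective j k p≤ q≤ (∷-injectiveʳ eq) = refl , p≡q

partitions≤-unique : ∀ m n → Unique (partitions≤ m n)
partitions≤-unique zero    zero    = [] ∷ []
partitions≤-unique zero    (suc n) = []
partitions≤-unique (suc m) n =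
  Uniqueₚ.concat⁺
    (Allₚ.map⁺ (All.universal
      (λ k → Uniqueₚ.map⁺ (++-cancelˡ (replicate k (suc m)) _ _) (partitions≤-unique m (n ∸ k * suc m)))
      (upTo (suc (n / suc m)))))
    (AllPairsₚ.map⁺ (AllPairsₚ.applyUpTo⁺₁ _ (suc (n / suc m)) (λ {j} {k} j<k _ (p∈j , p∈k) → disjoint j k j<k p∈j p∈k)))
  where
  row : ℕ → List (List ℕ)
  row k = map (replicate k (suc m) ++_) (partitions≤ m (n ∸ k * suc m))

  disjoint : ∀ j k → j < k → ∀ {p} → p ∈ row j → ¬ (p ∈ row k)
  disjoint j k j<k p∈j p∈k
    with q , q∈ , refl ← ∈-map⁻ (replicate j (suc m) ++_) p∈j
    with q′ , q′∈ , eq ← ∈-map⁻ (replicate k (suc m) ++_) p∈k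
    = <⇒≢ j<k (proj₁ (replicate-++-injective j k
        (proj₂ (partitions≤-sound m _ q∈)) (proj₂ (partitions≤-sound m _ q′∈)) eq))

partitions-unique : ∀ n → Unique (partitions n)
partitions-unique n = partitions≤-unique n n

{-# OPTIONS --safe #-}
module Submission where

-- A simply paired partition is a pair (μ, δ) of partitions into distinct parts,
-- μ listing the sizes of multiplicity 2 or 3 and δ those of odd multiplicity;
-- then b = #μ, r = max μ, and s is the alternating sum of δ.  For s = k > r the
-- sum over μ of (-1)^b q^(2|μ|) is (1 - q²)(1 - q⁴)⋯(1 - q^(2k-2)), while
-- the δ with parts at most m and s = k have generating function q^k times the
-- Gaussian binomial [m choose k] in q².  For m → ∞ the product of the two becomes
-- q^k / (1 - q^2k), and Σ_k q^k / (1 - q^2k) counts odd divisors.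

open import Defs
open import Data.Nat using (ℕ; _≥_)
open import Data.Integer using (+_; _-_)
open import Relation.Binary.PropositionalEquality using (_≡_)

open import Data.Bool using (if_then_else_; true; false)
open import Data.Integer as ℤ using (ℤ; 0ℤ; 1ℤ; -_; _+_; _*_; -[1+_])
import Data.Integer.Properties as ℤₚ
open import Algebra.Properties.AbelianGroup ℤₚ.+-0-abelianGroup using (∙-cancelʳ)
open import Data.Integer.Tactic.RingSolver using (solve-∀)
open import Data.List using (List; []; _∷_; _++_; map; filter; length; replicate; concatMap; applyUpTo; upTo)
open import Data.List.Extrema.Nat using (max; max≈v⁺)
open import Data.List.Membership.Propositional using (_∈_)
import Data.List.Properties as Listₚ
open import Data.List.Relation.Unary.All as All using (All; []; _∷_)
import Data.List.Relation.Unary.All.Properties as Allₚ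
open import Data.List.Relation.Unary.Any using (here; there)
open import Data.Nat as ℕ using (zero; suc; _∸_; _/_; _≤_; _<_; _≟_; _≤?_; z≤n; s≤s)
open import Data.Nat.Divisibility using (_∣_; _∣?_; >⇒∤; ∣-refl; ∣1⇒≡1; n∣m*n; ∣m+n∣m⇒∣n; ∣m∣n⇒∣m+n)
open import Data.Nat.DivMod using (m/n*n≤m; m*n/n≡m; /-monoˡ-≤)
import Data.Nat.Properties as ℕₚ
import Data.Nat.Tactic.RingSolver as ℕ-Ring
open import Data.Product using (_×_; _,_; proj₁; proj₂)
open import Data.Sum using (_⊎_; inj₁; inj₂)
open import Function using (_⇔_; mk⇔; Equivalence; _∘_)
open import Relation.Binary.PropositionalEquality using (refl; sym; trans; cong; cong₂; subst; _≗_; module ≡-Reasoning)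
open import Relation.Nullary using (Dec; does; yes; no; ¬_; ¬?; _×-dec_; _⊎-dec_; contradiction)
open import Relation.Nullary.Decidable using (dec-true; dec-false; does-⇔)
open import Relation.Unary using (Decidable)

-- The pair (μ, δ) is never built. The list of partitions recurses on the largest part M, so the
-- factorization has to come out of the same recursion. Copies of M leave r alone or replace it by
-- M, and leave s alone or reflect it to M - s. Hence the sum is taken for an arbitrary function of
-- (r, s), and each multiplicity of M transforms that function. The reflection also governs the δ
-- side: s = k after adding M means s = M - k before. This index can leave the range 0, ..., M - 1,
-- which is why k is an integer, and it turns the recurrence into the q-Pascal rule for the
-- complementary binomial. Series are bare coefficient functions, acted on only by q^a, 1 - q^a and
-- sums. Quotients are therefore avoided: identities are multiplied out and the factors 1 - q^a are
-- cancelled afterwards. The limit m → ∞ becomes m = n, for which the coefficient of q^n is already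
-- exact.

-- Power series and the operators q^a and 1 - q^a

Series : Set
Series = ℕ → ℤ

private variable
  f g : Series
  A B : Set

-- Multiplication by q^a.
shift : ℕ → Series → Series
shift zero    f n       = f n
shift (suc a) f zero    = 0ℤ
shift (suc a) f (suc n) = shift a f n

-- A factor q^a gains a orders of precision, hence the bound `a ℕ.+ N`.
shift-cong-≤ : ∀ a {N} → (∀ n → n ≤ N → f n ≡ g n) →
               ∀ n → n ≤ a ℕ.+ N → shift a f n ≡ shift a g n
shift-cong-≤ zero    f≈g n       n≤       = f≈g n n≤
shift-cong-≤ (suc a) f≈g zero    n≤       = refl
shift-cong-≤ (suc a) f≈g (suc n) (s≤s n≤) = shift-cong-≤ a f≈g n n≤

shift-cong : ∀ a → f ≗ g → shift a f ≗ shift a g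
shift-cong zero    f≗g n       = f≗g n
shift-cong (suc a) f≗g zero    = refl
shift-cong (suc a) f≗g (suc n) = shift-cong a f≗g n

shift-congˡ : ∀ {a c} → a ≡ c → shift a f ≗ shift c f
shift-congˡ refl n = refl

shift-+ : ∀ a f g → shift a (λ n → f n + g n) ≗ λ n → shift a f n + shift a g n
shift-+ zero    f g n       = refl
shift-+ (suc a) f g zero    = refl
shift-+ (suc a) f g (suc n) = shift-+ a f g n

shift-neg : ∀ a f → shift a (λ n → - f n) ≗ λ n → - shift a f n
shift-neg zero    f n       = refl
shift-neg (suc a) f zero    = refl
shift-neg (suc a) f (suc n) = shift-neg a f n

shift-- : ∀ a f g → shift a (λ n → f n - g n) ≗ λ n → shift a f n - shift a g n
shift-- a f g n = trans (shift-+ a f (λ n → - g n) n) (cong (λ x → shift a f n + x) (shift-neg a g n))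

shift-0 : ∀ a → shift a (λ _ → 0ℤ) ≗ λ _ → 0ℤ
shift-0 zero    n       = refl
shift-0 (suc a) zero    = refl
shift-0 (suc a) (suc n) = shift-0 a n

shift-shift : ∀ a c f → shift a (shift c f) ≗ shift (a ℕ.+ c) f
shift-shift zero    c f n       = refl
shift-shift (suc a) c f zero    = refl
shift-shift (suc a) c f (suc n) = shift-shift a c f n

shift-comm : ∀ a c f → shift a (shift c f) ≗ shift c (shift a f)
shift-comm a c f n = trans (shift-shift a c f n)
  (trans (shift-congˡ (ℕₚ.+-comm a c) n) (sym (shift-shift c a f n)))

shift-< : ∀ {a n} f → n < a → shift a f n ≡ 0ℤ
shift-< {suc a} {zero}  f n<a       = refl
shift-< {suc a} {suc n} f (s≤s n<a) = shift-< f n<a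

shift-≥ : ∀ {a n} f → a ≤ n → shift a f n ≡ f (n ∸ a)
shift-≥ f z≤n       = refl
shift-≥ f (s≤s a≤n) = shift-≥ f a≤n

1-q^ : ℕ → Series → Series
1-q^ a f n = f n - shift a f n

1-q^-cong : ∀ a → f ≗ g → 1-q^ a f ≗ 1-q^ a g
1-q^-cong a f≗g n = cong₂ _-_ (f≗g n) (shift-cong a f≗g n)

private
  interchange⁺ : ∀ w x y z → (w + x) - (y + z) ≡ (w - y) + (x - z)
  interchange⁺ = solve-∀

  interchange⁻ : ∀ w x y z → (w - x) - (y - z) ≡ (w - y) - (x - z)
  interchange⁻ = solve-∀

1-q^-+ : ∀ a f g → 1-q^ a (λ n → f n + g n) ≗ λ n → 1-q^ a f n + 1-q^ a g n
1-q^-+ a f g n = trans (cong (λ x → f n + g n - x) (shift-+ a f g n))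
                       (interchange⁺ (f n) (g n) (shift a f n) (shift a g n))

1-q^-shift : ∀ a c f → 1-q^ a (shift c f) ≗ shift c (1-q^ a f)
1-q^-shift a c f n = trans (cong (λ x → shift c f n - x) (shift-comm a c f n))
                           (sym (shift-- c f (shift a f) n))

1-q^-comm : ∀ a c f → 1-q^ a (1-q^ c f) ≗ 1-q^ c (1-q^ a f)
1-q^-comm a c f n = begin
  1-q^ c f n - shift a (1-q^ c f) n                   ≡⟨ cong (λ x → 1-q^ c f n - x) (sym (1-q^-shift c a f n)) ⟩
  1-q^ c f n - 1-q^ c (shift a f) n                   ≡⟨ interchange⁻ (f n) _ _ _ ⟩
  1-q^ a f n - (shift c f n - shift c (shift a f) n)  ≡⟨ cong (λ x → 1-q^ a f n - x) (sym (shift-- c f (shift a f) n)) ⟩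
  1-q^ c (1-q^ a f) n                              ∎
  where open ≡-Reasoning

-- The constant term of 1 - q^(a+1) is 1, so each coefficient is determined by the image and by
-- strictly lower coefficients. Since nothing above order N enters, cancellation also works for
-- truncated series.
1-q^-injective-≤ : ∀ a N → (∀ n → n ≤ N → 1-q^ (suc a) f n ≡ 1-q^ (suc a) g n) →
                   ∀ n → n ≤ N → f n ≡ g n
1-q^-injective-≤ a N eq zero n≤N = ∙-cancelʳ 0ℤ _ _ (eq zero n≤N)
1-q^-injective-≤ {f} {g} a (suc N) eq (suc n) (s≤s n≤N) = ∙-cancelʳ (- shift a f n) _ _
  (trans (eq (suc n) (s≤s n≤N)) (cong (λ x → g (suc n) - x) (sym below)))
  where
  below : shift a f n ≡ shift a g n
  below = shift-cong-≤ a
    (1-q^-injective-≤ a N (λ i i≤N → eq i (ℕₚ.m≤n⇒m≤1+n i≤N)))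
    n (ℕₚ.≤-trans n≤N (ℕₚ.m≤n+m N a))

-- q-Pochhammer products

-- Multiplication by (q²; q²)ᵢ.
poch : ℕ → Series → Series
poch zero    f = f
poch (suc i) f = 1-q^ (2 ℕ.* suc i) (poch i f)

poch-cong : ∀ i → f ≗ g → poch i f ≗ poch i g
poch-cong zero    f≗g = f≗g
poch-cong (suc i) f≗g = 1-q^-cong (2 ℕ.* suc i) (poch-cong i f≗g)

poch-+ : ∀ i f g → poch i (λ n → f n + g n) ≗ λ n → poch i f n + poch i g n
poch-+ zero    f g n = refl
poch-+ (suc i) f g n = trans (1-q^-cong (2 ℕ.* suc i) (poch-+ i f g) n)
                             (1-q^-+ (2 ℕ.* suc i) (poch i f) (poch i g) n)

poch-shift : ∀ i a f → poch i (shift a f) ≗ shift a (poch i f)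
poch-shift zero    a f n = refl
poch-shift (suc i) a f n = trans (1-q^-cong (2 ℕ.* suc i) (poch-shift i a f) n)
                                 (1-q^-shift (2 ℕ.* suc i) a (poch i f) n)

poch-1-q^ : ∀ i a f → poch i (1-q^ a f) ≗ 1-q^ a (poch i f)
poch-1-q^ zero    a f n = refl
poch-1-q^ (suc i) a f n = trans (1-q^-cong (2 ℕ.* suc i) (poch-1-q^ i a f) n)
                                (1-q^-comm (2 ℕ.* suc i) a (poch i f) n)

poch-comm : ∀ i j f → poch i (poch j f) ≗ poch j (poch i f)
poch-comm i zero    f n = refl
poch-comm i (suc j) f n = trans (poch-1-q^ i (2 ℕ.* suc j) (poch j f) n)
                                (1-q^-cong (2 ℕ.* suc j) (poch-comm i j f) n)

poch-injective-≤ : ∀ i {N} → (∀ n → n ≤ N → poch i f n ≡ poch i g n) →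
                   ∀ n → n ≤ N → f n ≡ g n
poch-injective-≤ zero    eq = eq
poch-injective-≤ (suc i) eq = poch-injective-≤ i (1-q^-injective-≤ _ _ eq)

one : Series
one zero    = 1ℤ
one (suc _) = 0ℤ

-- The additional factors 1 - q^(2j) have j > l, so they first act at order 2(l + 1), beyond l.
poch-+-≤ : ∀ k l n → n ≤ l → poch (k ℕ.+ l) one n ≡ poch l one n
poch-+-≤ zero    l n n≤l = refl
poch-+-≤ (suc k) l n n≤l = begin
  poch (k ℕ.+ l) one n - shift (2 ℕ.* suc (k ℕ.+ l)) (poch (k ℕ.+ l) one) n
    ≡⟨ cong (λ x → poch (k ℕ.+ l) one n - x) (shift-< _ n<) ⟩
  poch (k ℕ.+ l) one n - 0ℤ
    ≡⟨ ℤₚ.+-identityʳ _ ⟩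
  poch (k ℕ.+ l) one n
    ≡⟨ poch-+-≤ k l n n≤l ⟩
  poch l one n ∎
  where
  open ≡-Reasoning
  n< : n < 2 ℕ.* suc (k ℕ.+ l)
  n< = ℕₚ.≤-trans (s≤s (ℕₚ.≤-trans n≤l (ℕₚ.m≤n+m l k))) (ℕₚ.m≤m+n _ _)

-- Indicators of decidable propositions

indicator : Dec A → ℤ
indicator a? = if does a? then 1ℤ else 0ℤ

indicator-yes : (a? : Dec A) → A → indicator a? ≡ 1ℤ
indicator-yes a? a = cong (if_then 1ℤ else 0ℤ) (dec-true a? a)

indicator-no : (a? : Dec A) → ¬ A → indicator a? ≡ 0ℤ
indicator-no a? ¬a = cong (if_then 1ℤ else 0ℤ) (dec-false a? ¬a)

indicator-⇔ : A ⇔ B → (a? : Dec A) (b? : Dec B) → indicator a? ≡ indicator b?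
indicator-⇔ A⇔B a? b? = cong (if_then 1ℤ else 0ℤ) (does-⇔ A⇔B a? b?)

indicator-× : (a? : Dec A) (b? : Dec B) → indicator (a? ×-dec b?) ≡ indicator a? * indicator b?
indicator-× a? b? with does a? | does b?
... | true  | true  = refl
... | true  | false = refl
... | false | _     = refl

-- Partitions into distinct parts by size and alternating sum

-- The coefficient of zᵏ in the generating function Σ q^|δ| z^s(δ) of the
-- partitions δ into distinct parts at most m.
distinctGF : ℕ → ℤ → Series
distinctGF zero    k n = if does (k ℤ.≟ 0ℤ) then one n else 0ℤ
distinctGF (suc m) k n = distinctGF m k n + shift (suc m) (distinctGF m (+ suc m - k)) n

private
  m-[m+1+j] : ∀ m j → + suc m - + suc (suc m ℕ.+ j) ≡ -[1+ j ]
  m-[m+1+j] m j = begin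
    + suc m - + suc (suc m ℕ.+ j)        ≡⟨ ℤₚ.m-n≡m⊖n (suc m) (suc (suc m ℕ.+ j)) ⟩
    suc m ℤ.⊖ suc (suc m ℕ.+ j)          ≡⟨ cong₂ ℤ._⊖_ (sym (ℕₚ.+-identityʳ (suc m))) (sym (ℕₚ.+-suc (suc m) j)) ⟩
    (suc m ℕ.+ 0) ℤ.⊖ (suc m ℕ.+ suc j)  ≡⟨ ℤₚ.+-cancelˡ-⊖ (suc m) 0 (suc j) ⟩
    -[1+ j ]                             ∎
    where open ≡-Reasoning

  [k+l]-k : ∀ k l → + (k ℕ.+ l) - + k ≡ + l
  [k+l]-k k l = trans (ℤₚ.m-n≡m⊖n (k ℕ.+ l) k)
    (trans (cong ((k ℕ.+ l) ℤ.⊖_) (sym (ℕₚ.+-identityʳ k))) (ℤₚ.+-cancelˡ-⊖ k l 0))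

-- An alternating sum of decreasing parts at most m lies between 0 and m. The two halves are proved
-- together because the reflection k ↦ m + 1 - k exchanges the indices below this range with those
-- above it.
distinctGF-neg : ∀ m j n → distinctGF m -[1+ j ] n ≡ 0ℤ
distinctGF-big : ∀ m j n → distinctGF m (+ suc (m ℕ.+ j)) n ≡ 0ℤ

distinctGF-neg zero    j n = refl
distinctGF-neg (suc m) j n = cong₂ _+_ (distinctGF-neg m j n)
  (trans (shift-cong (suc m) (distinctGF-big m (suc j)) n) (shift-0 (suc m) n))

distinctGF-big zero    j n = refl
distinctGF-big (suc m) j n = cong₂ _+_
  (subst (λ t → distinctGF m (+ suc t) n ≡ 0ℤ) (ℕₚ.+-suc m j) (distinctGF-big m (suc j) n))
  (trans (shift-cong (suc m) (λ i → trans (cong (λ t → distinctGF m t i) (m-[m+1+j] m j))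
                                            (distinctGF-neg m j i)) n)
         (shift-0 (suc m) n))

distinctGF-0 : ∀ m → distinctGF m 0ℤ ≗ one
distinctGF-0 zero    n = refl
distinctGF-0 (suc m) n = begin
  distinctGF m 0ℤ n + shift (suc m) (distinctGF m (+ suc (m ℕ.+ 0))) n
    ≡⟨ cong₂ _+_ (distinctGF-0 m n) (shift-cong (suc m) (distinctGF-big m 0) n) ⟩
  one n + shift (suc m) (λ _ → 0ℤ) n
    ≡⟨ cong (λ x → one n + x) (shift-0 (suc m) n) ⟩
  one n + 0ℤ
    ≡⟨ ℤₚ.+-identityʳ (one n) ⟩
  one n ∎
  where open ≡-Reasoning

-- Alternating sum m is attained only by the single part m: what follows m must have alternating sum
-- 0, hence be empty.
distinctGF-top : ∀ m → distinctGF m (+ m) ≗ shift m one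
distinctGF-top zero    n = refl
distinctGF-top (suc m) n = begin
  distinctGF m (+ suc m) n + shift (suc m) (distinctGF m (+ suc m - + suc m)) n
    ≡⟨ cong₂ _+_ (subst (λ t → distinctGF m (+ suc t) n ≡ 0ℤ) (ℕₚ.+-identityʳ m) (distinctGF-big m 0 n))
                 (cong (λ k → shift (suc m) (distinctGF m k) n) (ℤₚ.+-inverseʳ (+ suc m))) ⟩
  0ℤ + shift (suc m) (distinctGF m 0ℤ) n
    ≡⟨ ℤₚ.+-identityˡ _ ⟩
  shift (suc m) (distinctGF m 0ℤ) n
    ≡⟨ shift-cong (suc m) (distinctGF-0 m) n ⟩
  shift (suc m) one n ∎
  where open ≡-Reasoning

-- q^c (1 - q^2d) + q^(c+d) q^d (1 - q^2c) = q^c (1 - q^2(c+d))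
split-1-q^ : ∀ c d f n →
  1-q^ (2 ℕ.* d) (shift c f) n + shift (c ℕ.+ d) (1-q^ (2 ℕ.* c) (shift d f)) n
  ≡ shift c (1-q^ (2 ℕ.* (c ℕ.+ d)) f) n
split-1-q^ c d f n = begin
  (shift c f n - shift (2 ℕ.* d) (shift c f) n) + shift (c ℕ.+ d) (1-q^ (2 ℕ.* c) (shift d f)) n
    ≡⟨ cong₂ (λ x y → (shift c f n - x) + y)
         (trans (shift-shift (2 ℕ.* d) c f n) (shift-congˡ (eq₁ c d) n))
         (trans (shift-- (c ℕ.+ d) (shift d f) _ n)
                (cong₂ _-_ (shift-shift (c ℕ.+ d) d f n)
                  (trans (shift-cong (c ℕ.+ d) (shift-shift (2 ℕ.* c) d f) n)
                    (trans (shift-shift (c ℕ.+ d) _ f n) (shift-congˡ (eq₂ c d) n))))) ⟩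
  (shift c f n - shift (c ℕ.+ d ℕ.+ d) f n) + (shift (c ℕ.+ d ℕ.+ d) f n - shift (c ℕ.+ 2 ℕ.* (c ℕ.+ d)) f n)
    ≡⟨ telescope (shift c f n) _ _ ⟩
  shift c f n - shift (c ℕ.+ 2 ℕ.* (c ℕ.+ d)) f n
    ≡⟨ cong (λ x → shift c f n - x) (sym (shift-shift c (2 ℕ.* (c ℕ.+ d)) f n)) ⟩
  shift c f n - shift c (shift (2 ℕ.* (c ℕ.+ d)) f) n
    ≡⟨ sym (shift-- c f _ n) ⟩
  shift c (1-q^ (2 ℕ.* (c ℕ.+ d)) f) n ∎
  where
  open ≡-Reasoning
  telescope : ∀ x y z → (x - y) + (y - z) ≡ x - z
  telescope = solve-∀
  eq₁ : ∀ c d → 2 ℕ.* d ℕ.+ c ≡ c ℕ.+ d ℕ.+ d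
  eq₁ = ℕ-Ring.solve-∀
  eq₂ : ∀ c d → c ℕ.+ d ℕ.+ (2 ℕ.* c ℕ.+ d) ≡ c ℕ.+ 2 ℕ.* (c ℕ.+ d)
  eq₂ = ℕ-Ring.solve-∀

-- distinctGF N (+ k) is q^k times the Gaussian binomial [N choose k] in q²,
-- stated without division.
poch-distinctGF : ∀ N k l → k ℕ.+ l ≡ N →
                  poch l (poch k (distinctGF N (+ k))) ≗ shift k (poch N one)
poch-distinctGF N       zero    l       refl n = poch-cong l (distinctGF-0 l) n
poch-distinctGF (suc N) (suc k) zero    eq n with refl ← trans (sym (ℕₚ.+-identityʳ k)) (ℕₚ.suc-injective eq) =
  trans (poch-cong (suc k) (distinctGF-top (suc k)) n) (poch-shift (suc k) (suc k) one n)
poch-distinctGF (suc N) (suc k) (suc l) eq n with refl ← ℕₚ.suc-injective eq = begin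
  poch (suc l) (poch (suc k) (distinctGF M (+ suc k))) n
    ≡⟨ poch-cong (suc l) (poch-+ (suc k) _ _) n ⟩
  poch (suc l) (λ i → poch (suc k) (distinctGF N (+ suc k)) i
                    + poch (suc k) (shift M (distinctGF N (+ M - + suc k))) i) n
    ≡⟨ poch-+ (suc l) _ _ n ⟩
  poch (suc l) (poch (suc k) (distinctGF N (+ suc k))) n
  + poch (suc l) (poch (suc k) (shift M (distinctGF N (+ M - + suc k)))) n
    -- With c = k + 1 and d = l + 1 this is the q-Pascal rule [M, c] = [N, c] + q^(2d) [N, c - 1] in
    -- q², with its denominators cleared.
    ≡⟨ cong₂ _+_ (1-q^-cong (2 ℕ.* suc l) (poch-distinctGF N (suc k) l (sym (ℕₚ.+-suc k l))) n) complement ⟩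
  1-q^ (2 ℕ.* suc l) (shift (suc k) X) n + shift M (1-q^ (2 ℕ.* suc k) (shift (suc l) X)) n
    ≡⟨ split-1-q^ (suc k) (suc l) X n ⟩
  shift (suc k) (poch M one) n ∎
  where
  open ≡-Reasoning
  M = suc N
  X = poch N one

  -- The reflected index M - (k + 1) is l + 1, so the induction hypothesis applies with the roles of
  -- the two Pochhammer factors exchanged. This is the symmetry of the binomials.
  complement : poch (suc l) (poch (suc k) (shift M (distinctGF N (+ M - + suc k)))) n
             ≡ shift M (1-q^ (2 ℕ.* suc k) (shift (suc l) X)) n
  complement = begin
    poch (suc l) (poch (suc k) (shift M (distinctGF N (+ M - + suc k)))) n
      ≡⟨ cong (λ t → poch (suc l) (poch (suc k) (shift M (distinctGF N t))) n) ([k+l]-k (suc k) (suc l)) ⟩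
    poch (suc l) (poch (suc k) (shift M (distinctGF N (+ suc l)))) n
      ≡⟨ poch-comm (suc l) (suc k) _ n ⟩
    poch (suc k) (poch (suc l) (shift M (distinctGF N (+ suc l)))) n
      ≡⟨ poch-cong (suc k) (poch-shift (suc l) M _) n ⟩
    poch (suc k) (shift M (poch (suc l) (distinctGF N (+ suc l)))) n
      ≡⟨ poch-shift (suc k) M _ n ⟩
    shift M (poch (suc k) (poch (suc l) (distinctGF N (+ suc l)))) n
      ≡⟨ shift-cong M (1-q^-cong (2 ℕ.* suc k) (poch-distinctGF N (suc l) k
           (trans (cong suc (ℕₚ.+-comm l k)) (sym (ℕₚ.+-suc k l))))) n ⟩
    shift M (1-q^ (2 ℕ.* suc k) (shift (suc l) X)) n ∎

-- (q²; q²)ₖ [k+l choose k] is the product of 1 - q²ʲ over l < j ≤ k + l, so it is 1 up to order l.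
poch-distinctGF-≤ : ∀ k l n → n ≤ k ℕ.+ l →
                    poch k (distinctGF (k ℕ.+ l) (+ k)) n ≡ shift k one n
-- Both sides are multiplied by (q²; q²)ₗ to reach the division-free identity; the factor is then
-- cancelled.
poch-distinctGF-≤ k l = poch-injective-≤ l λ n n≤ → begin
  poch l (poch k (distinctGF (k ℕ.+ l) (+ k))) n ≡⟨ poch-distinctGF (k ℕ.+ l) k l refl n ⟩
  shift k (poch (k ℕ.+ l) one) n                 ≡⟨ shift-cong-≤ k (poch-+-≤ k l) n n≤ ⟩
  shift k (poch l one) n                         ≡⟨ sym (poch-shift l k one n) ⟩
  poch l (shift k one) n                         ∎
  where open ≡-Reasoning

-- Divisibility as geometric series

-- For a ≥ 1 this is 1 / (1 - q^a); the constant term 1 is present because a divides 0.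
multiples : ℕ → Series
multiples a n = indicator (a ∣? n)

1-q^-multiples : ∀ a → 1-q^ (suc a) (multiples (suc a)) ≗ one
1-q^-multiples a n with ℕₚ.<-≤-connex n (suc a)
1-q^-multiples a zero    | inj₁ _   = refl
1-q^-multiples a (suc n) | inj₁ n<a = cong₂ _-_ (indicator-no (suc a ∣? suc n) (>⇒∤ n<a))
                                                (shift-< (multiples (suc a)) n<a)
1-q^-multiples a (suc n) | inj₂ (s≤s a≤n) = begin
  multiples (suc a) (suc n) - shift a (multiples (suc a)) n
    ≡⟨ cong₂ _-_ (indicator-⇔ (mk⇔ to from) (suc a ∣? suc n) (suc a ∣? (n ∸ a))) (shift-≥ _ a≤n) ⟩
  multiples (suc a) (n ∸ a) - multiples (suc a) (n ∸ a)
    ≡⟨ ℤₚ.+-inverseʳ (multiples (suc a) (n ∸ a)) ⟩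
  0ℤ ∎
  where
  open ≡-Reasoning
  1+n≡ : suc a ℕ.+ (n ∸ a) ≡ suc n
  1+n≡ = cong suc (ℕₚ.m+[n∸m]≡n a≤n)
  to : suc a ∣ suc n → suc a ∣ n ∸ a
  to a∣n = ∣m+n∣m⇒∣n (subst (suc a ∣_) (sym 1+n≡) a∣n) ∣-refl
  from : suc a ∣ n ∸ a → suc a ∣ suc n
  from a∣ = subst (suc a ∣_) 1+n≡ (∣m∣n⇒∣m+n ∣-refl a∣)

-- (1 - q^2k) (1 / (1 - q^k) - 1 / (1 - q^2k)) = (1 + q^k) - 1
1-q^-odd-multiples : ∀ k → 1-q^ (2 ℕ.* suc k) (λ n → multiples (suc k) n - multiples (2 ℕ.* suc k) n)
                          ≗ shift (suc k) one
1-q^-odd-multiples k n = begin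
  (F n - H n) - shift (2 ℕ.* suc k) (λ i → F i - H i) n
    ≡⟨ cong (λ x → (F n - H n) - x) (trans (shift-- (2 ℕ.* suc k) F H n)
         (cong (λ x → x - shift (2 ℕ.* suc k) H n)
           (trans (shift-congˡ (cong (suc k ℕ.+_) (ℕₚ.+-identityʳ (suc k))) n) (sym (shift-shift (suc k) (suc k) F n))))) ⟩
  (F n - H n) - (shift (suc k) (shift (suc k) F) n - shift (2 ℕ.* suc k) H n)
    -- On `F`, 1 - q^(2a) is written as (1 - q^a) + q^a (1 - q^a), where a = k + 1.
    ≡⟨ regroup (F n) (H n) (shift (suc k) F n) _ _ ⟩
  (1-q^ (suc k) F n + (shift (suc k) F n - shift (suc k) (shift (suc k) F) n)) - 1-q^ (2 ℕ.* suc k) H n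
    ≡⟨ cong₂ _-_ (cong₂ _+_ (1-q^-multiples k n)
          (trans (1-q^-shift (suc k) (suc k) F n) (shift-cong (suc k) (1-q^-multiples k) n)))
        (1-q^-multiples _ n) ⟩
  (one n + shift (suc k) one n) - one n
    ≡⟨ cancel (one n) _ ⟩
  shift (suc k) one n ∎
  where
  open ≡-Reasoning
  F = multiples (suc k)
  H = multiples (2 ℕ.* suc k)
  regroup : ∀ a b a′ a″ b′ → (a - b) - (a″ - b′) ≡ ((a - a′) + (a′ - a″)) - (b - b′)
  regroup = solve-∀
  cancel : ∀ x y → (x + y) - x ≡ y
  cancel = solve-∀

-- Pairs smaller than s = k + 1 supply only the first k factors, one fewer than the binomial's
-- denominator has. The missing 1 - q^(2(k+1)) is what remains below q^(k+1); multiplying by it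
-- reduces the claim to a truncated identity valid up to order n.
poch-distinctGF-multiples : ∀ k n → k < n →
  poch k (distinctGF n (+ suc k)) n ≡ multiples (suc k) n - multiples (2 ℕ.* suc k) n
poch-distinctGF-multiples k n k<n = 1-q^-injective-≤
  {poch k (distinctGF n (+ suc k))} {λ i → multiples (suc k) i - multiples (2 ℕ.* suc k) i} _ n
  (λ i i≤n → trans (truncated i i≤n) (sym (1-q^-odd-multiples k i))) n ℕₚ.≤-refl
  where
  truncated : ∀ i → i ≤ n → poch (suc k) (distinctGF n (+ suc k)) i ≡ shift (suc k) one i
  truncated = subst (λ t → ∀ i → i ≤ t → poch (suc k) (distinctGF t (+ suc k)) i ≡ shift (suc k) one i)
    (ℕₚ.m+[n∸m]≡n k<n) (poch-distinctGF-≤ (suc k) (n ∸ suc k))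

-- Finite sums and sums over lists

∑ : ℕ → (ℕ → ℤ) → ℤ
∑ zero    f = 0ℤ
∑ (suc n) f = f 0 + ∑ n (f ∘ suc)

∑-cong-< : ∀ n → (∀ i → i < n → f i ≡ g i) → ∑ n f ≡ ∑ n g
∑-cong-< zero    eq = refl
∑-cong-< (suc n) eq = cong₂ _+_ (eq 0 (s≤s z≤n)) (∑-cong-< n (λ i i<n → eq (suc i) (s≤s i<n)))

∑-cong : ∀ n → f ≗ g → ∑ n f ≡ ∑ n g
∑-cong n eq = ∑-cong-< n (λ i _ → eq i)

∑-zero : ∀ n → (∀ i → f i ≡ 0ℤ) → ∑ n f ≡ 0ℤ
∑-zero zero    eq = refl
∑-zero (suc n) eq = cong₂ _+_ (eq 0) (∑-zero n (eq ∘ suc))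

∑-- : ∀ n f g → ∑ n (λ i → f i - g i) ≡ ∑ n f - ∑ n g
∑-- zero    f g = refl
∑-- (suc n) f g = trans (cong (λ x → (f 0 - g 0) + x) (∑-- n (f ∘ suc) (g ∘ suc)))
                        (regroup (f 0) (g 0) _ _)
  where
  regroup : ∀ x y z w → (x - y) + (z - w) ≡ (x + z) - (y + w)
  regroup = solve-∀

∑-extend : ∀ a c → (∀ i → a ≤ i → f i ≡ 0ℤ) → ∑ (a ℕ.+ c) f ≡ ∑ a f
∑-extend zero        c eq = ∑-zero c (λ i → eq i z≤n)
∑-extend {f} (suc a) c eq = cong (λ x → f 0 + x) (∑-extend a c (λ i a≤i → eq (suc i) (s≤s a≤i)))

-- Neither bound is assumed to be the larger one, so both sums are compared with the sum up to a +
-- c.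
∑-support : ∀ a c → (∀ i → a ≤ i → f i ≡ 0ℤ) → (∀ i → c ≤ i → f i ≡ 0ℤ) → ∑ a f ≡ ∑ c f
∑-support {f} a c eqᵃ eqᶜ = trans (sym (∑-extend a c eqᵃ))
  (trans (cong (λ n → ∑ n f) (ℕₚ.+-comm a c)) (∑-extend c a eqᶜ))

∑-single : ∀ n i → i < n → (∀ j → ¬ j ≡ i → f j ≡ 0ℤ) → ∑ n f ≡ f i
∑-single {f} (suc n) zero    i<n       eq =
  trans (cong (λ x → f 0 + x) (∑-zero n (λ j → eq (suc j) λ ()))) (ℤₚ.+-identityʳ (f 0))
∑-single {f} (suc n) (suc i) (s≤s i<n) eq =
  trans (cong₂ _+_ (eq 0 λ ()) (∑-single n i i<n (λ j j≢i → eq (suc j) (j≢i ∘ ℕₚ.suc-injective))))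
        (ℤₚ.+-identityˡ (f (suc i)))

∑-double : ∀ n → (∀ i → f (i ℕ.* 2) ≡ 0ℤ) → ∑ (n ℕ.* 2) f ≡ ∑ n (λ i → f (suc (i ℕ.* 2)))
∑-double zero        eq = refl
∑-double {f} (suc n) eq = trans (cong₂ (λ x y → x + (f 1 + y)) (eq 0) (∑-double n (eq ∘ suc)))
                                (ℤₚ.+-identityˡ _)

sumOver : (A → ℤ) → List A → ℤ
sumOver w []       = 0ℤ
sumOver w (x ∷ xs) = w x + sumOver w xs

sumOver-cong-∈ : ∀ {v w : A → ℤ} xs → (∀ {x} → x ∈ xs → v x ≡ w x) → sumOver v xs ≡ sumOver w xs
sumOver-cong-∈ []       eq = refl
sumOver-cong-∈ (x ∷ xs) eq = cong₂ _+_ (eq (here refl)) (sumOver-cong-∈ xs (eq ∘ there))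

sumOver-cong : ∀ {v w : A → ℤ} xs → v ≗ w → sumOver v xs ≡ sumOver w xs
sumOver-cong xs eq = sumOver-cong-∈ xs (λ {x} _ → eq x)

sumOver-++ : ∀ (w : A → ℤ) xs ys → sumOver w (xs ++ ys) ≡ sumOver w xs + sumOver w ys
sumOver-++ w []       ys = sym (ℤₚ.+-identityˡ _)
sumOver-++ w (x ∷ xs) ys = trans (cong (λ t → w x + t) (sumOver-++ w xs ys))
                                 (sym (ℤₚ.+-assoc (w x) _ _))

sumOver-map : ∀ (w : B → ℤ) (u : A → B) xs → sumOver w (map u xs) ≡ sumOver (w ∘ u) xs
sumOver-map w u []       = refl
sumOver-map w u (x ∷ xs) = cong (λ t → w (u x) + t) (sumOver-map w u xs)

sumOver-applyUpTo : ∀ (w : A → ℤ) u n → sumOver w (applyUpTo u n) ≡ ∑ n (w ∘ u)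
sumOver-applyUpTo w u zero    = refl
sumOver-applyUpTo w u (suc n) = cong (λ t → w (u 0) + t) (sumOver-applyUpTo w (u ∘ suc) n)

sumOver-concatMap : ∀ (w : B → ℤ) (u : A → List B) xs →
                    sumOver w (concatMap u xs) ≡ sumOver (sumOver w ∘ u) xs
sumOver-concatMap w u []       = refl
sumOver-concatMap w u (x ∷ xs) = trans (sumOver-++ w (u x) (concatMap u xs))
                                       (cong (λ t → sumOver w (u x) + t) (sumOver-concatMap w u xs))

sumOver-0 : ∀ (xs : List A) → sumOver (λ _ → 0ℤ) xs ≡ 0ℤ
sumOver-0 []       = refl
sumOver-0 (x ∷ xs) = trans (ℤₚ.+-identityˡ _) (sumOver-0 xs)

sumOver-+ : ∀ (v w : A → ℤ) xs → sumOver (λ x → v x + w x) xs ≡ sumOver v xs + sumOver w xs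
sumOver-+ v w []       = refl
sumOver-+ v w (x ∷ xs) = trans (cong (λ t → (v x + w x) + t) (sumOver-+ v w xs)) (regroup (v x) (w x) _ _)
  where
  regroup : ∀ x y z w → (x + y) + (z + w) ≡ (x + z) + (y + w)
  regroup = solve-∀

sumOver-neg : ∀ (w : A → ℤ) xs → sumOver (λ x → - w x) xs ≡ - sumOver w xs
sumOver-neg w []       = refl
sumOver-neg w (x ∷ xs) = trans (cong (λ t → - w x + t) (sumOver-neg w xs))
                               (sym (ℤₚ.neg-distrib-+ (w x) _))

count-indicator : ∀ {P : A → Set} (P? : Decidable P) xs → + count P? xs ≡ sumOver (indicator ∘ P?) xs
count-indicator P? []       = refl
count-indicator P? (x ∷ xs) with does (P? x)
... | true  = cong (λ t → 1ℤ + t) (count-indicator P? xs)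
... | false = trans (count-indicator P? xs) (sym (ℤₚ.+-identityˡ _))

-- Part sizes after adding copies of a new largest part

-- `b`, `r` and `s` are the length, the maximum and the alternating sum of such lists, so one
-- accept/reject pair of lemmas serves all three.
sizesWith : {P : ℕ → Set} → Decidable P → List ℕ → List ℕ
sizesWith P? λs = filter (λ i → P? (multiplicity λs i)) (partSizes λs)

filter-cong-All : ∀ {P Q : A → Set} (P? : Decidable P) (Q? : Decidable Q) {xs} →
                  All (λ x → does (P? x) ≡ does (Q? x)) xs → filter P? xs ≡ filter Q? xs
filter-cong-All P? Q? {[]}     []         = refl
filter-cong-All P? Q? {x ∷ xs} (eq ∷ eqs) with does (P? x) | does (Q? x) | eq
... | true  | true  | refl = cong (x ∷_) (filter-cong-All P? Q? eqs)
... | false | false | refl = filter-cong-All P? Q? eqs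

module _ {m : ℕ} where

  multiplicity-below : ∀ k q {i} → i ≤ m → multiplicity (replicate k (suc m) ++ q) i ≡ multiplicity q i
  multiplicity-below zero    q     i≤m = refl
  multiplicity-below (suc k) q {i} i≤m =
    trans (cong length (Listₚ.filter-reject (i ≟_) {xs = replicate k (suc m) ++ q} (ℕₚ.<⇒≢ (s≤s i≤m))))
          (multiplicity-below k q i≤m)

  multiplicity-largest : ∀ k {q} → All (_≤ m) q → multiplicity (replicate k (suc m) ++ q) (suc m) ≡ k
  multiplicity-largest zero    q≤ = cong length (Listₚ.filter-none (suc m ≟_) (All.map (λ x≤m → ℕₚ.>⇒≢ (s≤s x≤m)) q≤))
  multiplicity-largest (suc k) {q} q≤ =
    trans (cong length (Listₚ.filter-accept (suc m ≟_) {xs = replicate k (suc m) ++ q} refl))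
          (cong suc (multiplicity-largest k q≤))

  partSizes-≤ : ∀ {q} → All (_≤ m) q → All (_≤ m) (partSizes q)
  partSizes-≤ = Allₚ.deduplicate⁺ _≟_

  partSizes-replicate : ∀ k {q} → All (_≤ m) q →
                        partSizes (replicate (suc k) (suc m) ++ q) ≡ suc m ∷ partSizes q
  partSizes-replicate k {q} q≤ = cong (suc m ∷_) (others k)
    where
    other? : Decidable (λ x → ¬ suc m ≡ x)
    other? x = ¬? (suc m ≟ x)
    rest : filter other? (partSizes q) ≡ partSizes q
    rest = Listₚ.filter-all other? (All.map (λ x≤m → ℕₚ.>⇒≢ (s≤s x≤m)) (partSizes-≤ q≤))
    others : ∀ k → filter other? (partSizes (replicate k (suc m) ++ q)) ≡ partSizes q
    others zero    = rest
    others (suc k) = trans (cong (λ xs → filter other? (suc m ∷ xs)) (others k))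
      (trans (Listₚ.filter-reject other? {xs = partSizes q} (λ ¬eq → ¬eq refl)) rest)

  module _ {P : ℕ → Set} (P? : Decidable P) (k : ℕ) {q : List ℕ} (q≤ : All (_≤ m) q) where

    private
      λs = replicate (suc k) (suc m) ++ q

      Q? : Decidable (λ i → P (multiplicity λs i))
      Q? i = P? (multiplicity λs i)

      smaller : filter Q? (partSizes q) ≡ sizesWith P? q
      smaller = filter-cong-All Q? (λ i → P? (multiplicity q i))
        (All.map (λ i≤m → cong (does ∘ P?) (multiplicity-below (suc k) q i≤m)) (partSizes-≤ q≤))

      expand : sizesWith P? λs ≡ filter Q? (suc m ∷ partSizes q)
      expand = cong (filter Q?) (partSizes-replicate k q≤)

    sizesWith-accept : P (suc k) → sizesWith P? λs ≡ suc m ∷ sizesWith P? q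
    sizesWith-accept p = trans expand (trans
      (Listₚ.filter-accept Q? {xs = partSizes q} (subst P (sym (multiplicity-largest (suc k) q≤)) p))
      (cong (suc m ∷_) smaller))

    sizesWith-reject : ¬ P (suc k) → sizesWith P? λs ≡ sizesWith P? q
    sizesWith-reject ¬p = trans expand (trans
      (Listₚ.filter-reject Q? {xs = partSizes q} (¬p ∘ subst P (multiplicity-largest (suc k) q≤)))
      smaller)

  sizesWith-≤ : ∀ {P : ℕ → Set} (P? : Decidable P) {q} → All (_≤ m) q → All (_≤ m) (sizesWith P? q)
  sizesWith-≤ P? q≤ = Allₚ.filter⁺ _ (partSizes-≤ q≤)

  simplyPaired-replicate : ∀ k {q} → k ≤ 3 → All (_≤ m) q →
                           SimplyPaired (replicate k (suc m) ++ q) ⇔ SimplyPaired q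
  simplyPaired-replicate k {q} k≤3 q≤ = mk⇔ to from
    where
    to : SimplyPaired (replicate k (suc m) ++ q) → SimplyPaired q
    to sp = All.zipWith (λ (i≤m , ≤3) → subst (_≤ 3) (multiplicity-below k q i≤m) ≤3)
              (q≤ , Allₚ.++⁻ʳ (replicate k (suc m)) sp)
    from : SimplyPaired q → SimplyPaired (replicate k (suc m) ++ q)
    from sp = Allₚ.++⁺ (Allₚ.replicate⁺ k (subst (_≤ 3) (sym (multiplicity-largest k q≤)) k≤3))
      (All.zipWith (λ (i≤m , ≤3) → subst (_≤ 3) (sym (multiplicity-below k q i≤m)) ≤3) (q≤ , sp))

  ¬simplyPaired-replicate : ∀ k {q} → All (_≤ m) q → ¬ SimplyPaired (replicate (4 ℕ.+ k) (suc m) ++ q)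
  ¬simplyPaired-replicate k q≤ (≤3 ∷ _) with s≤s (s≤s (s≤s ())) ←
    subst (_≤ 3) (multiplicity-largest (4 ℕ.+ k) q≤) ≤3

-- Signed weights after adding copies of a new largest part

paired? : Decidable (λ k → k ≡ 2 ⊎ k ≡ 3)
paired? k = (k ≟ 2) ⊎-dec (k ≟ 3)

even-suc : ∀ n → ¬ (2 ∣ n) → 2 ∣ suc n
even-suc zero          odd = contradiction (n∣m*n 0) odd
even-suc (suc zero)    odd = ∣-refl
even-suc (suc (suc n)) odd = ∣m∣n⇒∣m+n ∣-refl (even-suc n (odd ∘ ∣m∣n⇒∣m+n ∣-refl))

odd-suc : ∀ n → 2 ∣ n → ¬ (2 ∣ suc n)
odd-suc n even even′ with () ← ∣1⇒≡1 (∣m+n∣m⇒∣n (subst (2 ∣_) (ℕₚ.+-comm 1 n) even′) even)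

-- This is (-1)^n, written as a difference so that the even count minus the odd count factors term
-- by term.
sign : ℕ → ℤ
sign n = indicator (even? n) - indicator (odd? n)

sign-even : ∀ {n} → 2 ∣ n → sign n ≡ 1ℤ
sign-even {n} even = cong₂ _-_ (indicator-yes (even? n) even) (indicator-no (odd? n) (λ odd → odd even))

sign-odd : ∀ {n} → ¬ (2 ∣ n) → sign n ≡ - 1ℤ
sign-odd {n} odd = cong₂ _-_ (indicator-no (even? n) odd) (indicator-yes (odd? n) odd)

sign-suc : ∀ n → sign (suc n) ≡ - sign n
sign-suc n with even? n
... | yes even = trans (sign-odd (odd-suc n even)) (cong -_ (sym (sign-even even)))
... | no odd   = trans (sign-even (even-suc n odd)) (cong -_ (sym (sign-odd odd)))

-- A function of r and s. Negative rank alone would not survive the induction on the largest part,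
-- which replaces the function by its pullbacks.
Weight : Set
Weight = ℕ → ℤ → ℤ

pairSign : List ℕ → ℤ
pairSign λs = indicator (simplyPaired? λs) * sign (b λs)

weight : Weight → List ℕ → ℤ
weight g λs = pairSign λs * g (r λs) (s λs)

-- The effect on a weight of adding k copies of a new largest part M.
step : ℕ → ℕ → Weight → Weight
step M 0 g r s = g r s
step M 1 g r s = g r (+ M - s)
step M 2 g r s = - g M s
step M 3 g r s = - g M (+ M - s)
step M (suc (suc (suc (suc _)))) g r s = 0ℤ

private
  2≤2 : 2 ≤ 2
  2≤2 = s≤s (s≤s z≤n)

  2≤3 : 2 ≤ 3
  2≤3 = s≤s (s≤s z≤n)

  odd-1 : Odd 1
  odd-1 = odd-suc 0 (n∣m*n 0)

  odd-3 : Odd 3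
  odd-3 = odd-suc 2 ∣-refl

module _ {m : ℕ} (g : Weight) {q : List ℕ} (q≤ : All (_≤ m) q) where

  private
    λs : ℕ → List ℕ
    λs k = replicate k (suc m) ++ q

    r-paired : ∀ k → 2 ≤ suc k → r (λs (suc k)) ≡ suc m
    r-paired k 2≤ = trans (cong (max 0) (sizesWith-accept (2 ≤?_) k q≤ 2≤))
      (max≈v⁺ (here refl) (ℕₚ.≤-refl ∷ All.map ℕₚ.m≤n⇒m≤1+n (sizesWith-≤ (2 ≤?_) q≤)) z≤n)

    r-single : r (λs 1) ≡ r q
    r-single = cong (max 0) (sizesWith-reject (2 ≤?_) 0 q≤ (λ { (s≤s ()) }))

    s-odd : ∀ k → Odd (suc k) → s (λs (suc k)) ≡ + suc m - s q
    s-odd k odd = cong alternatingSum (sizesWith-accept odd? k q≤ odd)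

    s-even : s (λs 2) ≡ s q
    s-even = cong alternatingSum (sizesWith-reject odd? 1 q≤ (λ odd → odd ∣-refl))

    pairSign-unpaired : pairSign (λs 1) ≡ pairSign q
    pairSign-unpaired = cong₂ _*_
      (indicator-⇔ (simplyPaired-replicate 1 (s≤s z≤n) q≤) (simplyPaired? (λs 1)) (simplyPaired? q))
      (cong (sign ∘ length) (sizesWith-reject paired? 0 q≤ (λ { (inj₁ ()) ; (inj₂ ()) })))

    pairSign-paired : ∀ k → suc k ≤ 3 → suc k ≡ 2 ⊎ suc k ≡ 3 → pairSign (λs (suc k)) ≡ - pairSign q
    pairSign-paired k ≤3 p = trans (cong₂ _*_
      (indicator-⇔ (simplyPaired-replicate (suc k) ≤3 q≤) (simplyPaired? (λs (suc k))) (simplyPaired? q))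
      (trans (cong (sign ∘ length) (sizesWith-accept paired? k q≤ p)) (sign-suc (b q))))
      (sym (ℤₚ.neg-distribʳ-* (indicator (simplyPaired? q)) (sign (b q))))

    weight-paired : ∀ k → suc k ≤ 3 → suc k ≡ 2 ⊎ suc k ≡ 3 → ∀ {t} → s (λs (suc k)) ≡ t →
                    weight g (λs (suc k)) ≡ pairSign q * - g (suc m) t
    weight-paired k ≤3 p s≡ = trans
      (cong₂ _*_ (pairSign-paired k ≤3 p) (cong₂ g (r-paired k (2≤ p)) s≡))
      (swap-neg (pairSign q) _)
      where
      2≤ : suc k ≡ 2 ⊎ suc k ≡ 3 → 2 ≤ suc k
      2≤ (inj₁ refl) = 2≤2
      2≤ (inj₂ refl) = 2≤3
      swap-neg : ∀ x y → - x * y ≡ x * - y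
      swap-neg = solve-∀

  -- The new part exceeds all others. An odd multiplicity puts it at the head of the alternating
  -- sum, multiplicity 2 or 3 makes it the value of r and flips the sign through one more pair, and
  -- multiplicity 4 or more destroys simple pairing.
  weight-replicate : ∀ k → weight g (replicate k (suc m) ++ q) ≡ weight (step (suc m) k g) q
  weight-replicate 0 = refl
  weight-replicate 1 = cong₂ _*_ pairSign-unpaired (cong₂ g r-single (s-odd 0 odd-1))
  weight-replicate 2 = weight-paired 1 (s≤s (s≤s z≤n)) (inj₁ refl) s-even
  weight-replicate 3 = weight-paired 2 ℕₚ.≤-refl (inj₂ refl) (s-odd 2 odd-3)
  weight-replicate (suc (suc (suc (suc k)))) = trans
    (cong (λ x → x * sign (b (λs (4 ℕ.+ k))) * g (r (λs (4 ℕ.+ k))) (s (λs (4 ℕ.+ k))))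
      (indicator-no (simplyPaired? (λs (4 ℕ.+ k))) (¬simplyPaired-replicate k q≤)))
    (sym (ℤₚ.*-zeroʳ (pairSign q)))

-- Signed generating functions and their recurrence

signedGF : ℕ → Weight → Series
signedGF m g n = sumOver (weight g) (partitions≤ m n)

module _ (m n : ℕ) where

  signedGF-cong : ∀ {g h : Weight} → (∀ r s → g r s ≡ h r s) → signedGF m g n ≡ signedGF m h n
  signedGF-cong eq = sumOver-cong (partitions≤ m n) (λ λs → cong (λ x → pairSign λs * x) (eq (r λs) (s λs)))

  signedGF-0 : signedGF m (λ _ _ → 0ℤ) n ≡ 0ℤ
  signedGF-0 = trans (sumOver-cong (partitions≤ m n) (λ λs → ℤₚ.*-zeroʳ (pairSign λs)))
                     (sumOver-0 (partitions≤ m n))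

  signedGF-+ : ∀ (g h : Weight) → signedGF m (λ r s → g r s + h r s) n ≡ signedGF m g n + signedGF m h n
  signedGF-+ g h = trans
    (sumOver-cong (partitions≤ m n) (λ λs → ℤₚ.*-distribˡ-+ (pairSign λs) _ _))
    (sumOver-+ (weight g) (weight h) (partitions≤ m n))

  signedGF-neg : ∀ (g : Weight) → signedGF m (λ r s → - g r s) n ≡ - signedGF m g n
  signedGF-neg g = trans
    (sumOver-cong (partitions≤ m n) (λ λs → sym (ℤₚ.neg-distribʳ-* (pairSign λs) _)))
    (sumOver-neg (weight g) (partitions≤ m n))

  signedGF-∑ : ∀ N (g : ℕ → Weight) → signedGF m (λ r s → ∑ N (λ k → g k r s)) n ≡ ∑ N (λ k → signedGF m (g k) n)
  signedGF-∑ zero    g = signedGF-0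
  signedGF-∑ (suc N) g = trans (signedGF-+ (g 0) (λ r s → ∑ N (λ k → g (suc k) r s)))
                               (cong (λ x → signedGF m (g 0) n + x) (signedGF-∑ N (g ∘ suc)))

-- The enumeration lets k run up to n / (m + 1), a range depending on n. The shift kills larger k
-- and `step` kills k ≥ 4, so the range can be fixed at 4, giving a recurrence between series.
signedGF-suc : ∀ m g n → signedGF (suc m) g n
                       ≡ ∑ 4 (λ k → shift (k ℕ.* suc m) (signedGF m (step (suc m) k g)) n)
signedGF-suc m g n = begin
  sumOver (weight g) (partitions≤ (suc m) n)
    ≡⟨ sumOver-concatMap (weight g) row (upTo (suc (n / suc m))) ⟩
  sumOver (sumOver (weight g) ∘ row) (upTo (suc (n / suc m)))
    ≡⟨ sumOver-applyUpTo (sumOver (weight g) ∘ row) (λ k → k) (suc (n / suc m)) ⟩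
  ∑ (suc (n / suc m)) (sumOver (weight g) ∘ row)
    ≡⟨ ∑-cong-< (suc (n / suc m)) sumOver-row ⟩
  ∑ (suc (n / suc m)) term
    ≡⟨ ∑-support (suc (n / suc m)) 4 too-large unpaired ⟩
  ∑ 4 term ∎
  where
  open ≡-Reasoning
  row : ℕ → List (List ℕ)
  row k = map (replicate k (suc m) ++_) (partitions≤ m (n ∸ k ℕ.* suc m))

  term : ℕ → ℤ
  term k = shift (k ℕ.* suc m) (signedGF m (step (suc m) k g)) n

  sumOver-row : ∀ k → k < suc (n / suc m) → sumOver (weight g) (row k) ≡ term k
  sumOver-row k (s≤s k≤) = begin
    sumOver (weight g) (row k)
      ≡⟨ sumOver-map (weight g) (replicate k (suc m) ++_) (partitions≤ m _) ⟩
    sumOver (weight g ∘ (replicate k (suc m) ++_)) (partitions≤ m _)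
      ≡⟨ sumOver-cong-∈ (partitions≤ m _)
           (λ q∈ → weight-replicate g (proj₂ (partitions≤-sound m _ q∈)) k) ⟩
    signedGF m (step (suc m) k g) (n ∸ k ℕ.* suc m)
      ≡⟨ sym (shift-≥ (signedGF m (step (suc m) k g)) (ℕₚ.≤-trans (ℕₚ.*-monoˡ-≤ (suc m) k≤) (m/n*n≤m n (suc m)))) ⟩
    term k ∎

  too-large : ∀ k → suc (n / suc m) ≤ k → term k ≡ 0ℤ
  too-large k n/m<k = shift-< {k ℕ.* suc m} {n} (signedGF m (step (suc m) k g)) (ℕₚ.≰⇒> λ k*m≤n → ℕₚ.<⇒≱ n/m<k
    (subst (_≤ n / suc m) (m*n/n≡m k (suc m)) (/-monoˡ-≤ (suc m) k*m≤n)))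

  unpaired : ∀ k → 4 ≤ k → term k ≡ 0ℤ
  unpaired (suc (suc (suc (suc k)))) _ =
    trans (shift-cong (suc (suc (suc (suc k))) ℕ.* suc m) (λ i → signedGF-0 m i) n)
          (shift-0 (suc (suc (suc (suc k))) ℕ.* suc m) n)
  unpaired (suc (suc (suc zero))) (s≤s (s≤s (s≤s ())))
  unpaired (suc (suc zero)) (s≤s (s≤s ()))
  unpaired (suc zero) (s≤s ())

AgreeUpTo : ℕ → Weight → Weight → Set
AgreeUpTo m g h = ∀ r t → r ≤ m → t ≤ m → g r (+ t) ≡ h r (+ t)

step-cong-≤ : ∀ m k g h → AgreeUpTo (suc m) g h → AgreeUpTo m (step (suc m) k g) (step (suc m) k h)
step-cong-≤ m k g h eq r t r≤m t≤m = go k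
  where
  -- The reflected value M - t is again between 0 and M, so the range of agreement passes through
  -- the recurrence.
  M-t : ∀ {r} → r ≤ suc m → g r (+ suc m - + t) ≡ h r (+ suc m - + t)
  M-t {r} r≤M = subst (λ u → g r u ≡ h r u)
    (sym (trans (ℤₚ.m-n≡m⊖n (suc m) t) (ℤₚ.⊖-≥ (ℕₚ.m≤n⇒m≤1+n t≤m))))
    (eq r (suc m ∸ t) r≤M (ℕₚ.m∸n≤m (suc m) t))
  go : ∀ k → step (suc m) k g r (+ t) ≡ step (suc m) k h r (+ t)
  go 0 = eq r t (ℕₚ.m≤n⇒m≤1+n r≤m) (ℕₚ.m≤n⇒m≤1+n t≤m)
  go 1 = M-t (ℕₚ.m≤n⇒m≤1+n r≤m)
  go 2 = cong -_ (eq (suc m) t ℕₚ.≤-refl (ℕₚ.m≤n⇒m≤1+n t≤m))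
  go 3 = cong -_ (M-t ℕₚ.≤-refl)
  go (suc (suc (suc (suc k)))) = refl

-- True because r and s lie between 0 and the largest part allowed.
signedGF-cong-≤ : ∀ m g h → AgreeUpTo m g h → signedGF m g ≗ signedGF m h
signedGF-cong-≤ zero    g h eq zero    = cong (λ x → pairSign [] * x + 0ℤ) (eq 0 0 z≤n z≤n)
signedGF-cong-≤ zero    g h eq (suc n) = refl
signedGF-cong-≤ (suc m) g h eq n = begin
  signedGF (suc m) g n
    ≡⟨ signedGF-suc m g n ⟩
  ∑ 4 (λ k → shift (k ℕ.* suc m) (signedGF m (step (suc m) k g)) n)
    ≡⟨ ∑-cong 4 (λ k → shift-cong (k ℕ.* suc m) (signedGF-cong-≤ m (step (suc m) k g) (step (suc m) k h) (step-cong-≤ m k g h eq)) n) ⟩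
  ∑ 4 (λ k → shift (k ℕ.* suc m) (signedGF m (step (suc m) k h)) n)
    ≡⟨ sym (signedGF-suc m h n) ⟩
  signedGF (suc m) h n ∎
  where open ≡-Reasoning

-- The factorization for bounded r and fixed s

-- The target is k = i + 1, that is, negative rank with s = k. The two parameters are kept
-- independent because the recursion reflects k and leaves i alone.
threshold : ℕ → ℤ → Weight
threshold i k r s = indicator (r ≤? i ×-dec s ℤ.≟ k)

private
  M-s≡k : ∀ M s k → M - s ≡ k ⇔ s ≡ M - k
  M-s≡k M s k = mk⇔ (λ eq → trans (flip M s) (cong (λ x → M - x) eq)) (λ eq → trans (cong (λ x → M - x) eq) (sym (flip M k)))
    where
    flip : ∀ M s → s ≡ M - (M - s)
    flip = solve-∀

threshold-reflect : ∀ M i k r s → threshold i k r (M - s) ≡ threshold i (M - k) r s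
threshold-reflect M i k r s = indicator-⇔
  (mk⇔ (λ (r≤ , eq) → r≤ , Equivalence.to (M-s≡k M s k) eq) (λ (r≤ , eq) → r≤ , Equivalence.from (M-s≡k M s k) eq))
  (r ≤? i ×-dec (M - s) ℤ.≟ k) (r ≤? i ×-dec s ℤ.≟ (M - k))

threshold-> : ∀ {i r} k s → i < r → threshold i k r s ≡ 0ℤ
threshold-> {i} {r} k s i<r = indicator-no (r ≤? i ×-dec s ℤ.≟ k) (ℕₚ.<⇒≱ i<r ∘ proj₁)

threshold-≤ : ∀ {i j r r′} k s → r ≤ i → r′ ≤ j → threshold i k r s ≡ threshold j k r′ s
threshold-≤ {i} {j} {r} {r′} k s r≤i r′≤j = indicator-⇔
  (mk⇔ (λ (_ , eq) → r′≤j , eq) (λ (_ , eq) → r≤i , eq))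
  (r ≤? i ×-dec s ℤ.≟ k) (r′ ≤? j ×-dec s ℤ.≟ k)

-- Multiplicities 0 to 3 of the largest part M amount to two independent choices, M in δ or not and
-- M in μ or not. The first gives the recurrence of `distinctGF`; the second gives 1 - q^(2M) if M ≤
-- i and 1 otherwise.
signedGF-threshold : ∀ m i k → i ≤ m → signedGF m (threshold i k) ≗ poch i (distinctGF m k)
signedGF-threshold zero zero k z≤n n with k ℤ.≟ 0ℤ
signedGF-threshold zero zero k z≤n zero    | yes refl = refl
signedGF-threshold zero zero k z≤n (suc n) | yes refl = refl
signedGF-threshold zero zero k z≤n zero    | no k≢0   =
  cong (λ x → 1ℤ * x + 0ℤ) (indicator-no (0 ≤? 0 ×-dec 0ℤ ℤ.≟ k) (λ (_ , eq) → k≢0 (sym eq)))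
signedGF-threshold zero zero k z≤n (suc n) | no k≢0   = refl
signedGF-threshold (suc m) i k i≤ n = begin
  signedGF M τ n
    ≡⟨ signedGF-suc m τ n ⟩
  signedGF m τ n + (shift (1 ℕ.* M) (signedGF m (step M 1 τ)) n
    + (shift (2 ℕ.* M) (signedGF m (step M 2 τ)) n
    + (shift (3 ℕ.* M) (signedGF m (step M 3 τ)) n + 0ℤ)))
    ≡⟨ cong₂ (λ x y → signedGF m τ n + (x + y))
         (trans (shift-congˡ (ℕₚ.+-identityʳ M) n)
           (shift-cong M (λ j → signedGF-cong m j (threshold-reflect (+ M) i k)) n))
         (cong₂ (λ x y → x + (y + 0ℤ))
           (trans (shift-cong (2 ℕ.* M) (λ j → signedGF-neg m j (λ _ s → τ M s)) n) (shift-neg (2 ℕ.* M) _ n))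
           -- Three copies are a pair and a single copy, so q^(3M) is split as q^(2M) q^M to expose
           -- the common factor q^(2M).
           (trans (shift-cong (3 ℕ.* M) (λ j → trans (signedGF-neg m j (λ _ s → τ M (+ M - s)))
                     (cong -_ (signedGF-cong m j (λ _ s → threshold-reflect (+ M) i k M s)))) n)
             (trans (shift-neg (3 ℕ.* M) _ n)
               (cong -_ (trans (shift-congˡ (ℕₚ.+-comm M (2 ℕ.* M)) n) (sym (shift-shift (2 ℕ.* M) M _ n))))))) ⟩
  signedGF m τ n + (shift M (signedGF m τ′) n
    + (- shift (2 ℕ.* M) (signedGF m (λ _ s → τ M s)) n
    + (- shift (2 ℕ.* M) (shift M (signedGF m (λ _ s → τ′ M s))) n + 0ℤ)))
    ≡⟨ regroup (signedGF m τ n) (shift M (signedGF m τ′) n) (shift (2 ℕ.* M) (signedGF m (λ _ s → τ M s)) n) _ ⟩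
  (signedGF m τ n + shift M (signedGF m τ′) n)
    - (shift (2 ℕ.* M) (signedGF m (λ _ s → τ M s)) n + shift (2 ℕ.* M) (shift M (signedGF m (λ _ s → τ′ M s))) n)
    ≡⟨ cong (λ x → (signedGF m τ n + shift M (signedGF m τ′) n) - x)
         (sym (shift-+ (2 ℕ.* M) (signedGF m (λ _ s → τ M s)) (shift M (signedGF m (λ _ s → τ′ M s))) n)) ⟩
  (signedGF m τ n + shift M (signedGF m τ′) n)
    - shift (2 ℕ.* M) (λ j → signedGF m (λ _ s → τ M s) j + shift M (signedGF m (λ _ s → τ′ M s)) j) n
    ≡⟨ by-cases (ℕₚ.m≤n⇒m<n∨m≡n i≤) ⟩
  poch i (distinctGF M k) n ∎
  where
  open ≡-Reasoning
  M = suc m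
  τ = threshold i k
  τ′ = threshold i (+ M - k)

  regroup : ∀ x y z w → x + (y + (- z + (- w + 0ℤ))) ≡ (x + y) - (z + w)
  regroup = solve-∀

  by-cases : i < M ⊎ i ≡ M →
    (signedGF m τ n + shift M (signedGF m τ′) n)
      - shift (2 ℕ.* M) (λ j → signedGF m (λ _ s → τ M s) j + shift M (signedGF m (λ _ s → τ′ M s)) j) n
    ≡ poch i (distinctGF M k) n
  -- A paired M would make r exceed i, so both paired terms vanish and no factor is added.
  by-cases (inj₁ (s≤s i≤m)) = begin
    _ ≡⟨ cong₂ _-_
           (cong₂ _+_ (signedGF-threshold m i k i≤m n) (shift-cong M (signedGF-threshold m i (+ M - k) i≤m) n))
           (trans (shift-cong (2 ℕ.* M) (λ j → cong₂ _+_ (vanish k j)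
                    (trans (shift-cong M (vanish (+ M - k)) j) (shift-0 M j))) n)
             (shift-0 (2 ℕ.* M) n)) ⟩
    (poch i (distinctGF m k) n + shift M (poch i (distinctGF m (+ M - k))) n) - 0ℤ
      ≡⟨ ℤₚ.+-identityʳ _ ⟩
    poch i (distinctGF m k) n + shift M (poch i (distinctGF m (+ M - k))) n
      ≡⟨ cong (λ x → poch i (distinctGF m k) n + x) (sym (poch-shift i M _ n)) ⟩
    poch i (distinctGF m k) n + poch i (shift M (distinctGF m (+ M - k))) n
      ≡⟨ sym (poch-+ i _ _ n) ⟩
    poch i (distinctGF M k) n ∎
    where
    vanish : ∀ k j → signedGF m (λ _ s → threshold i k M s) j ≡ 0ℤ
    vanish k j = trans (signedGF-cong m j (λ _ s → threshold-> k s (s≤s i≤m))) (signedGF-0 m j)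
  -- With i = M the bound on r holds for every partition involved, paired M or not. All four terms
  -- thus reduce to the bound m on parts at most m, leaving the factor 1 - q^(2M).
  by-cases (inj₂ refl) = begin
    _ ≡⟨ cong₂ _-_
           (cong₂ _+_ (below k n) (shift-cong M (below (+ M - k)) n))
           (shift-cong (2 ℕ.* M) (λ j → cong₂ _+_ (at k j) (shift-cong M (at (+ M - k)) j)) n) ⟩
    1-q^ (2 ℕ.* M) (λ j → poch m (distinctGF m k) j + shift M (poch m (distinctGF m (+ M - k))) j) n
      ≡⟨ 1-q^-cong (2 ℕ.* M) (λ j → trans
           (cong (λ x → poch m (distinctGF m k) j + x) (sym (poch-shift m M _ j)))
           (sym (poch-+ m _ _ j))) n ⟩
    poch M (distinctGF M k) n ∎
    where
    below : ∀ k j → signedGF m (threshold M k) j ≡ poch m (distinctGF m k) j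
    below k j = trans
      (signedGF-cong-≤ m (threshold M k) (threshold m k) (λ r t r≤m _ → threshold-≤ {M} {m} {r} {r} k (+ t) (ℕₚ.m≤n⇒m≤1+n r≤m) r≤m) j)
      (signedGF-threshold m m k ℕₚ.≤-refl j)
    at : ∀ k j → signedGF m (λ _ s → threshold M k M s) j ≡ poch m (distinctGF m k) j
    at k j = trans
      (signedGF-cong-≤ m (λ _ s → threshold M k M s) (threshold m k) (λ r t r≤m _ → threshold-≤ {M} {m} {M} {r} k (+ t) ℕₚ.≤-refl r≤m) j)
      (signedGF-threshold m m k ℕₚ.≤-refl j)

-- Negative rank, odd divisors and the conclusion

negativeRank : Weight
negativeRank r s = indicator ((+ r - s) ℤₚ.<? 0ℤ)

-- Since r ≥ 0, negative rank forces s > 0. Then s = k + 1 singles out one summand, in which r < s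
-- reads r ≤ k; k < n suffices because s ≤ n.
negativeRank-threshold : ∀ n → AgreeUpTo n negativeRank (λ r s → ∑ n (λ k → threshold k (+ suc k) r s))
negativeRank-threshold n r zero    r≤n t≤n = trans
  (indicator-no ((+ r - 0ℤ) ℤₚ.<? 0ℤ) (λ r<0 → ℤₚ.<⇒≱ r<0 (subst (0ℤ ℤ.≤_) (sym (ℤₚ.+-identityʳ (+ r))) (ℤ.+≤+ z≤n))))
  (sym (∑-zero n (λ k → indicator-no (r ≤? k ×-dec 0ℤ ℤ.≟ + suc k) (λ { (_ , ()) }))))
negativeRank-threshold n r (suc t) r≤n t<n = trans
  (indicator-⇔ (mk⇔ to from) ((+ r - + suc t) ℤₚ.<? 0ℤ) (r ≤? t ×-dec + suc t ℤ.≟ + suc t))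
  (sym (∑-single n t t<n (λ k k≢t → indicator-no (r ≤? k ×-dec + suc t ℤ.≟ + suc k)
    (λ { (_ , refl) → k≢t refl }))))
  where
  to : + r - + suc t ℤ.< 0ℤ → r ≤ t × + suc t ≡ + suc t
  to r-t<0 = ℕₚ.≮⇒≥ (λ t<r → ℤₚ.<⇒≱ r-t<0 (ℤₚ.i≤j⇒0≤j-i (ℤ.+≤+ t<r))) , refl
  from : r ≤ t × + suc t ≡ + suc t → + r - + suc t ℤ.< 0ℤ
  from (r≤t , _) = ℤₚ.<-≤-trans (ℤₚ.+-monoˡ-< (- + suc t) (ℤ.+<+ (s≤s r≤t))) (ℤₚ.≤-reflexive (ℤₚ.+-inverseʳ (+ suc t)))

E-O≡signedGF : ∀ n → + Eₛₚ n - + Oₛₚ n ≡ signedGF n negativeRank n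
E-O≡signedGF n = begin
  + Eₛₚ n - + Oₛₚ n
    ≡⟨ cong₂ _-_ (count-indicator even-case? (partitions n)) (count-indicator odd-case? (partitions n)) ⟩
  sumOver (indicator ∘ even-case?) (partitions n) - sumOver (indicator ∘ odd-case?) (partitions n)
    ≡⟨ cong (λ x → sumOver (indicator ∘ even-case?) (partitions n) + x) (sym (sumOver-neg (indicator ∘ odd-case?) (partitions n))) ⟩
  sumOver (indicator ∘ even-case?) (partitions n) + sumOver (λ λs → - indicator (odd-case? λs)) (partitions n)
    ≡⟨ sym (sumOver-+ (indicator ∘ even-case?) (λ λs → - indicator (odd-case? λs)) (partitions n)) ⟩
  sumOver (λ λs → indicator (even-case? λs) - indicator (odd-case? λs)) (partitions n)
    ≡⟨ sumOver-cong (partitions n) difference ⟩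
  signedGF n negativeRank n ∎
  where
  open ≡-Reasoning
  even-case? = λ λs → simplyPaired? λs ×-dec (ρ λs ℤₚ.<? 0ℤ) ×-dec even? (b λs)
  odd-case?  = λ λs → simplyPaired? λs ×-dec (ρ λs ℤₚ.<? 0ℤ) ×-dec odd?  (b λs)

  indicator-×× : ∀ {A B C : Set} (a? : Dec A) (b? : Dec B) (c? : Dec C) →
                 indicator (a? ×-dec b? ×-dec c?) ≡ indicator a? * (indicator b? * indicator c?)
  indicator-×× a? b? c? = trans (indicator-× a? (b? ×-dec c?)) (cong (λ x → indicator a? * x) (indicator-× b? c?))

  factor : ∀ x y z w → x * (y * z) - x * (y * w) ≡ x * (z - w) * y
  factor = solve-∀

  difference : ∀ λs → indicator (even-case? λs) - indicator (odd-case? λs) ≡ weight negativeRank λs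
  difference λs = trans
    (cong₂ _-_ (indicator-×× (simplyPaired? λs) (ρ λs ℤₚ.<? 0ℤ) (even? (b λs)))
               (indicator-×× (simplyPaired? λs) (ρ λs ℤₚ.<? 0ℤ) (odd? (b λs))))
    (factor (indicator (simplyPaired? λs)) (indicator (ρ λs ℤₚ.<? 0ℤ)) (indicator (even? (b λs))) (indicator (odd? (b λs))))

even-divisors : ∀ n → n ≥ 1 →
  ∑ n (λ i → indicator (even? (suc i) ×-dec (suc i ∣? n))) ≡ ∑ n (λ i → multiples (2 ℕ.* suc i) n)
even-divisors n@(suc _) n≥1 = begin
  ∑ n evenDivisor
    -- No divisor of n exceeds n, so the range may be doubled to make room for the substitution d =
    -- 2(i + 1).
    ≡⟨ ∑-support n (n ℕ.* 2) too-large (λ i 2n≤i → too-large i (ℕₚ.≤-trans (ℕₚ.m≤m*n n 2) 2n≤i)) ⟩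
  ∑ (n ℕ.* 2) evenDivisor
    -- Index i stands for the divisor i + 1, so the even divisors sit at the odd indices.
    ≡⟨ ∑-double {evenDivisor} n (λ i → indicator-no (even? (suc (i ℕ.* 2)) ×-dec (suc (i ℕ.* 2) ∣? n)) (odd-suc (i ℕ.* 2) (n∣m*n i) ∘ proj₁)) ⟩
  ∑ n (λ i → evenDivisor (suc (i ℕ.* 2)))
    ≡⟨ ∑-cong n (λ i → indicator-⇔
         (mk⇔ (λ (_ , i*2∣n) → subst (_∣ n) (ℕₚ.*-comm (suc i) 2) i*2∣n)
              (λ 2*i∣n → n∣m*n (suc i) , subst (_∣ n) (ℕₚ.*-comm 2 (suc i)) 2*i∣n))
         (even? (suc i ℕ.* 2) ×-dec (suc i ℕ.* 2 ∣? n)) (2 ℕ.* suc i ∣? n)) ⟩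
  ∑ n (λ i → multiples (2 ℕ.* suc i) n) ∎
  where
  open ≡-Reasoning
  evenDivisor : ℕ → ℤ
  evenDivisor i = indicator (even? (suc i) ×-dec (suc i ∣? n))
  too-large : ∀ i → n ≤ i → evenDivisor i ≡ 0ℤ
  too-large i n≤i = indicator-no (even? (suc i) ×-dec (suc i ∣? n)) (λ (_ , i∣n) → >⇒∤ (s≤s n≤i) i∣n)

-- The summands on the right detect divisors d with n / d odd, not d odd, so the sums agree only in
-- total: both are the number of divisors minus the number of even divisors.
d-odd≡∑ : ∀ n → n ≥ 1 → + d-odd n ≡ ∑ n (λ i → multiples (suc i) n - multiples (2 ℕ.* suc i) n)
d-odd≡∑ n n≥1 = begin
  + d-odd n
    ≡⟨ count-indicator (λ d → odd? d ×-dec (d ∣? n)) (applyUpTo suc n) ⟩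
  sumOver (λ d → indicator (odd? d ×-dec (d ∣? n))) (applyUpTo suc n)
    ≡⟨ sumOver-applyUpTo _ suc n ⟩
  ∑ n (λ i → indicator (odd? (suc i) ×-dec (suc i ∣? n)))
    ≡⟨ ∑-cong n (λ i → odd-or-even (even? (suc i)) (suc i ∣? n)) ⟩
  ∑ n (λ i → multiples (suc i) n - indicator (even? (suc i) ×-dec (suc i ∣? n)))
    ≡⟨ ∑-- n _ _ ⟩
  ∑ n (λ i → multiples (suc i) n) - ∑ n (λ i → indicator (even? (suc i) ×-dec (suc i ∣? n)))
    ≡⟨ cong (λ x → ∑ n (λ i → multiples (suc i) n) - x) (even-divisors n n≥1) ⟩
  ∑ n (λ i → multiples (suc i) n) - ∑ n (λ i → multiples (2 ℕ.* suc i) n)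
    ≡⟨ sym (∑-- n _ _) ⟩
  ∑ n (λ i → multiples (suc i) n - multiples (2 ℕ.* suc i) n) ∎
  where
  open ≡-Reasoning
  odd-or-even : ∀ {A B : Set} (a? : Dec A) (b? : Dec B) →
                indicator (¬? a? ×-dec b?) ≡ indicator b? - indicator (a? ×-dec b?)
  odd-or-even a? b? with does a? | does b?
  ... | true  | true  = refl
  ... | true  | false = refl
  ... | false | true  = refl
  ... | false | false = refl

theorem6p2 : (n : ℕ) → n ≥ 1 → + Eₛₚ n - + Oₛₚ n ≡ + d-odd n
theorem6p2 n n≥1 = begin
  + Eₛₚ n - + Oₛₚ n
    ≡⟨ E-O≡signedGF n ⟩
  signedGF n negativeRank n
    ≡⟨ signedGF-cong-≤ n negativeRank (λ r s → ∑ n (λ k → threshold k (+ suc k) r s)) (negativeRank-threshold n) n ⟩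
  signedGF n (λ r s → ∑ n (λ k → threshold k (+ suc k) r s)) n
    ≡⟨ signedGF-∑ n n n (λ k → threshold k (+ suc k)) ⟩
  ∑ n (λ k → signedGF n (threshold k (+ suc k)) n)
    ≡⟨ ∑-cong-< n (λ k k<n → trans (signedGF-threshold n k (+ suc k) (ℕₚ.<⇒≤ k<n) n)
                                   (poch-distinctGF-multiples k n k<n)) ⟩
  ∑ n (λ k → multiples (suc k) n - multiples (2 ℕ.* suc k) n)
    ≡⟨ sym (d-odd≡∑ n n≥1) ⟩
  + d-odd n ∎
  where open ≡-Reasoning
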